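{- Let $\mathbb{0}=\{x\in\omega^\omega : x(n)=0 \text{ for all but finitely many } n\}$ and consider $P=\omega^\omega\setminus\mathbb{0}$ ordered by $\le^*$. Then $\mathfrak{icp}(P,\le^*)=\mathfrak{b}$ and $\mathfrak{cp}(P,\le^*)=\mathfrak{d}$.
   Context: For $x,y\in\omega^\omega$, $x\le^* y$ means $x(n)\le y(n)$ for all but finitely many $n$. For a poset (or preorder) $(P,\le)$: $F\subseteq P$ is a comparable family if for every $p\in P$ there is $q\in F$ with $p\le q$ or $q\le p$; $F$ is an incomparable family if for every $p\in P$ there is $q\in F$ with $p\not\le q$ and $q\not\le p$. $\mathfrak{cp}(P,\le)$ is the minimal size of a comparable family and $\mathfrak{icp}(P,\le)$ is the minimal size of an incomparable family. $\mathfrak{b}$ and $\mathfrak{d}$ are the usual bounding and dominating numbers of $(\omega^\omega,\le^*)$. -}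

module Defs where

open import Data.List.Base using (List)
import Data.List.Membership.Propositional as List
open import Data.Nat.Base using (ℕ; _≤_)
open import Data.Product.Base using (Σ; ∃; ∃-syntax; _×_; _,_; proj₁)
open import Data.Sum.Base using (_⊎_)
open import Function.Base using (_on_)
open import Function.Bundles using (_⇔_; _↣_; module Injection)
open import Level using (0ℓ; suc)
open import Relation.Binary.Core using (Rel)
open import Relation.Binary.PropositionalEquality.Core using (_≡_)
open import Relation.Nullary.Negation.Core using (¬_)
open import Relation.Unary using (Pred; _∈_; _∉_)

AllButFinitelyMany : Pred ℕ 0ℓ → Set
AllButFinitelyMany Q = ∃[ xs ] (∀ n → ¬ (n List.∈ xs) → Q n)

ω^ω : Set
ω^ω = ℕ → ℕ

infix 4 _≤*_
_≤*_ : Rel ω^ω 0ℓ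
x ≤* y = AllButFinitelyMany (λ n → x n ≤ y n)

𝟘 : Pred ω^ω 0ℓ
𝟘 x = AllButFinitelyMany (λ n → x n ≡ 0)

ω^ω∖𝟘 : Set
ω^ω∖𝟘 = ∃[ x ] x ∉ 𝟘

infix 4 _≤*ₚ_
_≤*ₚ_ : Rel ω^ω∖𝟘 0ℓ
_≤*ₚ_ = _≤*_ on proj₁

-- Cardinals are represented by sets κ (up to bijection).  F has size κ when F
-- is the range of an injection from κ; the type Σ A F itself would be too big,
-- since membership proofs need not be unique.
HasSize : {A : Set} → Pred A 0ℓ → Set → Set
HasSize {A} F κ = Σ (κ ↣ A) λ e → ∀ a → a ∈ F ⇔ (∃[ i ] Injection.to e i ≡ a)

-- Any two κ satisfying this inject into each other, so classically
-- (Cantor–Schröder–Bernstein) they are the same cardinal.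
IsMinimalSize : {A : Set} → Pred (Pred A 0ℓ) 0ℓ → Set → Set₁
IsMinimalSize {A} Φ κ =
  (∃[ F ] Φ F × HasSize F κ) ×
  (∀ (F : Pred A 0ℓ) (μ : Set) → Φ F → HasSize F μ → κ ↣ μ)

module _ {A : Set} (_≼_ : Rel A 0ℓ) where

  IsComparableFamily : Pred (Pred A 0ℓ) 0ℓ
  IsComparableFamily F = ∀ p → ∃[ q ] q ∈ F × (p ≼ q ⊎ q ≼ p)

  IsIncomparableFamily : Pred (Pred A 0ℓ) 0ℓ
  IsIncomparableFamily F = ∀ p → ∃[ q ] q ∈ F × ¬ (p ≼ q) × ¬ (q ≼ p)

  Is-𝔠𝔭 : Set → Set₁
  Is-𝔠𝔭 = IsMinimalSize IsComparableFamily

  Is-𝔦𝔠𝔭 : Set → Set₁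
  Is-𝔦𝔠𝔭 = IsMinimalSize IsIncomparableFamily

IsUnboundedFamily : Pred (Pred ω^ω 0ℓ) 0ℓ
IsUnboundedFamily F = ¬ (∃[ g ] (∀ f → f ∈ F → f ≤* g))

IsDominatingFamily : Pred (Pred ω^ω 0ℓ) 0ℓ
IsDominatingFamily F = ∀ f → ∃[ g ] g ∈ F × f ≤* g

Is-𝔟 : Set → Set₁
Is-𝔟 = IsMinimalSize IsUnboundedFamily

Is-𝔡 : Set → Set₁
Is-𝔡 = IsMinimalSize IsDominatingFamily

-- Two descriptions of a cardinal are equal when both are realised, by the same
-- set.  This includes the existence of the minimum, so the equality cannot
-- hold vacuously.
infix 4 _≡ᶜ_
_≡ᶜ_ : (Set → Set₁) → (Set → Set₁) → Set₁
Φ ≡ᶜ Ψ = ∃[ κ ] Φ κ × Ψ κ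

{-# OPTIONS --safe #-}

-- Fix a strictly increasing majorant h of f : ω → ω and let q f be supported on
-- K = {0, h 0, h (h 0), …} with q f k = h (h k) for k ∈ K.  If p ≤* q f, then
-- p ∈ P vanishes almost everywhere outside K, so that consecutive elements of
-- its support are about as far apart as h makes them; if q f ≤* p, then p
-- is large on K.  In both cases f ≤* g p for a function g p read off p alone.
-- In the other direction proj₁ p ≤* g makes p comparable with max(g, 1).  So the
-- relations "comparable" and ≤* are Galois–Tukey equivalent, which yields both
-- equalities.
--
-- Excluded middle for all types is a choice operator, and the existence of the
-- cardinals is proved from it by Hönig's argument: a maximal set of pairwise
-- everywhere different elements of Π X projects bijectively onto some X i, and
-- this X i injects into all the others.
module Submission where

open import Axiom.ExcludedMiddle using (ExcludedMiddle)
open import Axiom.Extensionality.Propositional using (Extensionality)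
open import Data.Bool.Base using (Bool; true; false; T)
open import Data.Bool.Properties using (T-irrelevant)
open import Data.Empty using (⊥; ⊥-elim)
open import Data.List.Base using (upTo)
open import Data.List.Extrema.Nat using (max; xs≤max)
open import Data.List.Membership.Propositional.Properties using (∈-upTo⁺)
import Data.List.Relation.Unary.All as All
open import Data.Nat.Base using (ℕ; zero; _≤_; _<_; _⊔_; z≤n; s≤s)
  renaming (suc to 1+_)
open import Data.Nat.Properties
open import Data.Product.Base using (Σ; ∃; ∃-syntax; _×_; _,_; proj₁; proj₂)
open import Data.Sum.Base using (_⊎_; inj₁; inj₂; [_,_])
open import Data.Unit.Base using (tt)
open import Function.Base using (_∘_; id)
open import Function.Bundles using (_↣_; mk↣; mk⇔; module Injection; module Equivalence)
open import Function.Construct.Composition using (_↣-∘_)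
open import Level using (0ℓ; suc; Lift; lift; lower)
open import Relation.Binary.Core using (Rel)
open import Relation.Binary.Definitions using (Symmetric; tri<; tri≈; tri>)
open import Relation.Binary.PropositionalEquality
  using (_≡_; _≢_; refl; sym; trans; cong; subst)
open import Relation.Nullary.Decidable.Core
  using (Dec; yes; no; map′; isYes; toWitness; fromWitness; decidable-stable)
open import Relation.Nullary.Negation.Core using (¬_; contradiction)
open import Relation.Unary using (Pred; _∈_; _∉_; _⊆_; U)
open import Defs

private variable
  A B X : Set

-- Classical set theory

-- Sets of elements of X, as opposed to predicates, are Bool-valued, so that
-- mutual inclusion implies equality without propositional extensionality.
Subset : Set → Set
Subset X = X → Bool

∣_∣ : Subset X → Set
∣ S ∣ = ∃[ x ] T (S x)

image : (A → B) → Pred A 0ℓ → Pred B 0ℓ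
image r F b = ∃[ a ] a ∈ F × r a ≡ b

Monotone : Pred (Pred A 0ℓ) 0ℓ → Set₁
Monotone {A} Φ = ∀ {F G : Pred A 0ℓ} → F ⊆ G → Φ F → Φ G

T-ext : ∀ {b c} → (T b → T c) → (T c → T b) → b ≡ c
T-ext {false} {false} f g = refl
T-ext {false} {true}  f g = ⊥-elim (g tt)
T-ext {true}  {false} f g = ⊥-elim (f tt)
T-ext {true}  {true}  f g = refl

∣∣-≡ : (S : Subset X) {x y : ∣ S ∣} → proj₁ x ≡ proj₁ y → x ≡ y
∣∣-≡ S {x , t} {.x , u} refl = cong (x ,_) (T-irrelevant t u)

∣∣-hasSize : (S : Subset X) → HasSize (T ∘ S) ∣ S ∣
∣∣-hasSize S = mk↣ {to = proj₁} (∣∣-≡ S) , λ a →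
  mk⇔ (λ t → (a , t) , refl) (λ { ((_ , t) , refl) → t })

module Classical (em : ExcludedMiddle 0ℓ) where

  ¬¬-elim : ¬ ¬ A → A
  ¬¬-elim = decidable-stable em

  ¬∀⇒∃¬ : {P : Pred X 0ℓ} → ¬ (∀ x → P x) → ∃[ x ] ¬ P x
  ¬∀⇒∃¬ ¬∀ = ¬¬-elim λ ¬∃ → ¬∀ λ x → ¬¬-elim λ ¬Px → ¬∃ (x , ¬Px)

  opaque
    ⟨_⟩ : Pred X 0ℓ → Subset X
    ⟨ F ⟩ x = isYes (em {F x})

    ⟨⟩⁺ : {F : Pred X 0ℓ} → F ⊆ T ∘ ⟨ F ⟩
    ⟨⟩⁺ = fromWitness

    ⟨⟩⁻ : {F : Pred X 0ℓ} → T ∘ ⟨ F ⟩ ⊆ F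
    ⟨⟩⁻ = toWitness

  ⟨⟩-hasSize : (F : Pred X 0ℓ) → HasSize F ∣ ⟨ F ⟩ ∣
  ⟨⟩-hasSize F with e , ran ← ∣∣-hasSize ⟨ F ⟩ =
    e , λ a → mk⇔ (Equivalence.to (ran a) ∘ ⟨⟩⁺) (⟨⟩⁻ ∘ Equivalence.from (ran a))

  -- A point of the image is sent to the index of the preimage that its membership proof provides;
  -- `r` recovers the point from that index.
  ∣image∣↣ : {F : Pred A 0ℓ} {μ : Set} (r : A → B) → HasSize F μ → ∣ ⟨ image r F ⟩ ∣ ↣ μ
  ∣image∣↣ {F = F} {μ = μ} r (e , ran) = mk↣ {to = proj₁ ∘ pre} λ {x} {y} eq →
    ∣∣-≡ ⟨ image r F ⟩
      (trans (sym (proj₂ (pre x))) (trans (cong (r ∘ Injection.to e) eq) (proj₂ (pre y))))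
    where
    pre : (x : ∣ ⟨ image r F ⟩ ∣) → ∃[ i ] r (Injection.to e i) ≡ proj₁ x
    pre (b , t) with ⟨⟩⁻ t
    ... | a , a∈F , refl with Equivalence.to (ran a) a∈F
    ...   | i , refl = i , refl

  module CantorSchröderBernstein (f : A ↣ B) (g : B ↣ A) where
    open Injection f using () renaming (to to f₀; injective to f-inj)
    open Injection g using () renaming (to to g₀; injective to g-inj)

    -- Points whose chain of alternating preimages under `g` and `f` stops in `A`. The bijection is
    -- `f` on them and inverse to `g` elsewhere.
    data Orbit : A → Set where
      start : ∀ {a} → (∀ b → g₀ b ≢ a) → Orbit a
      next  : ∀ {a a′} → Orbit a → g₀ (f₀ a) ≡ a′ → Orbit a′

    Graph : A → B → Set
    Graph a b = (Orbit a × f₀ a ≡ b) ⊎ (¬ Orbit a × g₀ b ≡ a)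

    total : ∀ a → ∃[ b ] Graph a b
    total a with em {Orbit a}
    ... | yes o = f₀ a , inj₁ (o , refl)
    ... | no ¬o with b , eq ← ¬¬-elim (λ ¬∃ → ¬o (start λ b eq → ¬∃ (b , eq))) =
      b , inj₂ (¬o , eq)

    graph-injective : ∀ {a a′ b} → Graph a b → Graph a′ b → a ≡ a′
    graph-injective (inj₁ (_ , p))    (inj₁ (_ , q))    = f-inj (trans p (sym q))
    graph-injective (inj₁ (o , refl)) (inj₂ (¬o , q))   = contradiction (next o q) ¬o
    graph-injective (inj₂ (¬o , p))   (inj₁ (o , refl)) = contradiction (next o p) ¬o
    graph-injective (inj₂ (_ , p))    (inj₂ (_ , q))    = trans (sym p) q

    graph-functional : ∀ {a b b′} → Graph a b → Graph a b′ → b ≡ b′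
    graph-functional (inj₁ (_ , p))  (inj₁ (_ , q))  = trans (sym p) q
    graph-functional (inj₁ (o , _))  (inj₂ (¬o , _)) = contradiction o ¬o
    graph-functional (inj₂ (¬o , _)) (inj₁ (o , _))  = contradiction o ¬o
    graph-functional (inj₂ (_ , p))  (inj₂ (_ , q))  = g-inj (trans p (sym q))

    graph-surjective : ∀ b → ∃[ a ] Graph a b
    graph-surjective b with em {Orbit (g₀ b)}
    ... | yes (start ¬g)          = contradiction refl (¬g b)
    ... | yes (next {a = a} o eq) = a , inj₁ (o , g-inj eq)
    ... | no ¬o                   = g₀ b , inj₂ (¬o , refl)

    bijection : Σ (A ↣ B) λ h → ∀ b → ∃[ a ] Injection.to h a ≡ b
    bijection =
      mk↣ {to = proj₁ ∘ total} (λ {a} {a′} eq →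
        graph-injective (subst (Graph a) eq (proj₂ (total a))) (proj₂ (total a′))) ,
      λ b → let a , G = graph-surjective b in a , graph-functional (proj₂ (total a)) G

  HasSize-↣↣ : {F : Pred X 0ℓ} {μ ν : Set} → HasSize F μ → ν ↣ μ → μ ↣ ν → HasSize F ν
  HasSize-↣↣ (e , ran) i j with h , sur ← CantorSchröderBernstein.bijection i j =
    e ↣-∘ h , λ a → mk⇔
      (λ a∈F → let m , eq = Equivalence.to (ran a) a∈F ; n , eq′ = sur m in
        n , trans (cong (Injection.to e) eq′) eq)
      (λ (n , eq) → Equivalence.from (ran a) (Injection.to h n , eq))

  -- Maximal sets and the existence of minimal cardinals

  module Choice (ext : Extensionality 0ℓ 0ℓ) where

    infix 4 _⊑_
    _⊑_ : Rel (Subset X) 0ℓ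
    S ⊑ R = ∀ x → T (S x) → T (R x)

    ⊑-antisym : {S R : Subset X} → S ⊑ R → R ⊑ S → S ≡ R
    ⊑-antisym p q = ext λ x → T-ext (p x) (q x)

    ⋃ : Pred (Subset X) 0ℓ → Subset X
    ⋃ 𝒮 = ⟨ (λ x → ∃[ S ] S ∈ 𝒮 × T (S x)) ⟩

    ⋃-upper : {𝒮 : Pred (Subset X) 0ℓ} {S : Subset X} → S ∈ 𝒮 → S ⊑ ⋃ 𝒮
    ⋃-upper S∈ x x∈S = ⟨⟩⁺ (_ , S∈ , x∈S)

    ⋃-least : {𝒮 : Pred (Subset X) 0ℓ} {R : Subset X} → (∀ S → S ∈ 𝒮 → S ⊑ R) → ⋃ 𝒮 ⊑ R
    ⋃-least below x x∈ with S , S∈ , x∈S ← ⟨⟩⁻ x∈ = below S S∈ x x∈S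

    -- The Bourbaki-Witt construction. The union of the tower lies in the tower, so `step` adds
    -- nothing to it; linearity later carries the clique property through unions.
    module ZermeloTower (step : Subset X → Subset X) (inflationary : ∀ S → S ⊑ step S) where

      -- Subfamilies are Bool-valued to keep Tower in Set.
      data Tower : Subset X → Set where
        stepᵗ : ∀ {S} → Tower S → Tower (step S)
        ⋃ᵗ    : ∀ (𝒮 : Subset (Subset X)) → (∀ S → T (𝒮 S) → Tower S) → Tower (⋃ (T ∘ 𝒮))

      Extreme : Subset X → Set
      Extreme S = ∀ R → Tower R → R ⊑ S → R ≢ S → step R ⊑ S

      -- Induction on the tower: by extremality a step can leave the part below `S` only from `S`
      -- itself, and a union is above `step S` as soon as one member is.
      extreme-dichotomy : ∀ {S} → Extreme S → ∀ {R} → Tower R → R ⊑ S ⊎ step S ⊑ R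
      extreme-dichotomy {S} ex (stepᵗ {R} t) with extreme-dichotomy ex t
      ... | inj₂ sS⊑R = inj₂ λ x → inflationary R x ∘ sS⊑R x
      ... | inj₁ R⊑S with em {R ≡ S}
      ...   | yes refl = inj₂ λ _ → id
      ...   | no R≢S   = inj₁ (ex R t R⊑S R≢S)
      extreme-dichotomy {S} ex (⋃ᵗ 𝒮 ts) with em {∀ R → T (𝒮 R) → R ⊑ S}
      ... | yes below = inj₁ (⋃-least below)
      ... | no ¬below = inj₂ (¬¬-elim λ ¬above → ¬below λ R R∈ →
        [ id , (λ sS⊑R → ⊥-elim (¬above λ x → ⋃-upper R∈ x ∘ sS⊑R x)) ]
        (extreme-dichotomy ex (ts R R∈)))

      -- Induction on the tower. For a union, if `step R` were not below it, the dichotomy would put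
      -- every member below `R`, making `R` equal to the union.
      extreme : ∀ {S} → Tower S → Extreme S
      extreme (stepᵗ {S} t) R r R⊑ R≢ with extreme-dichotomy (extreme t) r
      ... | inj₂ sS⊑R = contradiction (⊑-antisym R⊑ sS⊑R) R≢
      ... | inj₁ R⊑S with em {R ≡ S}
      ...   | yes refl = λ _ → id
      ...   | no R≢S   = λ x → inflationary S x ∘ extreme t R r R⊑S R≢S x
      extreme (⋃ᵗ 𝒮 ts) R r R⊑ R≢ = ¬¬-elim λ ¬goal →
        R≢ (⊑-antisym R⊑ (⋃-least λ S S∈ → below ¬goal S S∈))
        where
        below : ¬ (step R ⊑ ⋃ (T ∘ 𝒮)) → ∀ S → T (𝒮 S) → S ⊑ R
        below ¬goal S S∈ with extreme-dichotomy (extreme (ts S S∈)) r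
        ... | inj₂ sS⊑R = λ x → sS⊑R x ∘ inflationary S x
        ... | inj₁ R⊑S with em {R ≡ S}
        ...   | yes refl = λ _ → id
        ...   | no R≢S   = ⊥-elim (¬goal λ x → ⋃-upper S∈ x ∘ extreme (ts S S∈) R r R⊑S R≢S x)

      linear : ∀ {S R} → Tower S → Tower R → S ⊑ R ⊎ R ⊑ S
      linear {S} s r with extreme-dichotomy (extreme s) r
      ... | inj₁ R⊑S  = inj₂ R⊑S
      ... | inj₂ sS⊑R = inj₁ λ x → sS⊑R x ∘ inflationary S x

      top : Subset X
      top = ⋃ (T ∘ ⟨ Tower ⟩)

      top-tower : Tower top
      top-tower = ⋃ᵗ ⟨ Tower ⟩ λ _ → ⟨⟩⁻

      top-closed : step top ⊑ top
      top-closed = ⋃-upper (⟨⟩⁺ (stepᵗ top-tower))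

    module MaximalClique (_#_ : Rel X 0ℓ) (#-sym : Symmetric _#_) where

      Clique : Subset X → Set
      Clique S = ∀ x y → T (S x) → T (S y) → x ≡ y ⊎ x # y

      Extends : Subset X → X → Set
      Extends S x = ¬ T (S x) × ∀ y → T (S y) → x # y

      -- Excluded middle acts as choice here: the witness stored in the decision is the chosen one.
      -- The decision is an argument so that proofs can match on it.
      Chosen : {S : Subset X} → Dec (∃ (Extends S)) → X → Set
      Chosen (yes (x , _)) z = z ≡ x
      Chosen (no _)        z = ⊥

      chosen-unique : ∀ {S} (d : Dec (∃ (Extends S))) {x y} → Chosen d x → Chosen d y → x ≡ y
      chosen-unique (yes _) p q = trans p (sym q)

      chosen-extends : ∀ {S} (d : Dec (∃ (Extends S))) {x} → Chosen d x → Extends S x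
      chosen-extends (yes (_ , e)) refl = e

      step : Subset X → Subset X
      step S = ⟨ (λ z → T (S z) ⊎ Chosen (em {∃ (Extends S)}) z) ⟩

      open ZermeloTower step (λ S x → ⟨⟩⁺ ∘ inj₁)

      step-clique : ∀ {S} → Clique S → Clique (step S)
      step-clique {S} cl x y x∈ y∈ with ⟨⟩⁻ x∈ | ⟨⟩⁻ y∈
      ... | inj₁ p | inj₁ q = cl x y p q
      ... | inj₁ p | inj₂ q = inj₂ (#-sym (proj₂ (chosen-extends em q) x p))
      ... | inj₂ p | inj₁ q = inj₂ (proj₂ (chosen-extends em p) y q)
      ... | inj₂ p | inj₂ q = inj₁ (chosen-unique em p q)

      tower-clique : ∀ {S} → Tower S → Clique S
      tower-clique (stepᵗ t)   = step-clique (tower-clique t)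
      tower-clique (⋃ᵗ 𝒮 ts) x y x∈ y∈ with ⟨⟩⁻ x∈ | ⟨⟩⁻ y∈
      ... | S , S∈ , p | R , R∈ , q with linear (ts S S∈) (ts R R∈)
      ...   | inj₁ S⊑R = tower-clique (ts R R∈) x y (S⊑R x p) q
      ...   | inj₂ R⊑S = tower-clique (ts S S∈) x y p (R⊑S y q)

      -- An element chosen to extend `top` would already lie in `top`, which is closed under `step`.
      maximal : ∃[ S ] Clique S × (∀ x → (∀ y → T (S y) → x # y) → T (S x))
      maximal = top , tower-clique top-tower , λ x x# → ¬¬-elim λ x∉ →
        no-extension em (λ z → top-closed z ∘ ⟨⟩⁺ ∘ inj₂) (x , x∉ , x#)
        where
        no-extension : (d : Dec (∃ (Extends top))) → (∀ z → Chosen d z → T (top z)) →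
                       ¬ ∃ (Extends top)
        no-extension (yes (x , x∉ , _)) closed _ = x∉ (closed x refl)
        no-extension (no ¬e)            closed   = ¬e

    -- An element of the maximal clique is determined by any single coordinate, so lifting `Y i` to
    -- the clique and projecting to `Y j` is injective.
    minimal-cardinal : {I : Set} → I → (Y : I → Set) → ∃[ i ] ∀ j → Y i ↣ Y j
    minimal-cardinal {I} i₀ Y = i , λ j → mk↣ {to = λ x → proj₁ (lift-to-S x) j} λ {x} {y} eq →
      let u , u∈ , uᵢ = lift-to-S x ; v , v∈ , vᵢ = lift-to-S y in
      trans (sym uᵢ) (trans (cong (λ w → w i) (clique-≡ u∈ v∈ j eq)) vᵢ)
      where
      _#_ : Rel (∀ i → Y i) 0ℓ
      x # y = ∀ i → x i ≢ y i

      open MaximalClique _#_ (λ x#y i → x#y i ∘ sym)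

      S : Subset (∀ i → Y i)
      S = proj₁ maximal

      clique-≡ : ∀ {u v} → T (S u) → T (S v) → ∀ j → u j ≡ v j → u ≡ v
      clique-≡ u∈ v∈ j eq with proj₁ (proj₂ maximal) _ _ u∈ v∈
      ... | inj₁ u≡v = u≡v
      ... | inj₂ u#v = contradiction eq (u#v j)

      ProjectsOnto : I → Set
      ProjectsOnto i = ∀ x → ∃[ u ] T (S u) × u i ≡ x

      -- Otherwise, points missed in each `Y i` form a function `w` everywhere different from the
      -- clique; by maximality `w` belongs to it and so differs from itself at `i₀`.
      some-projection : ∃ ProjectsOnto
      some-projection = ¬¬-elim λ none →
        let missed : ∀ i → ∃[ x ] ¬ (∃[ u ] T (S u) × u i ≡ x)
            missed i = ¬∀⇒∃¬ λ onto → none (i , onto)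
            w : ∀ i → Y i
            w i = proj₁ (missed i)
            w# : ∀ u → T (S u) → w # u
            w# u u∈ i eq = proj₂ (missed i) (u , u∈ , sym eq)
        in w# w (proj₂ (proj₂ maximal) w w#) i₀ refl

      i : I
      i = proj₁ some-projection

      lift-to-S : ProjectsOnto i
      lift-to-S = proj₂ some-projection

    -- Indexing by Bool-valued subsets keeps the index type in `Set`; an arbitrary `F` is replaced
    -- by `⟨ F ⟩`, which satisfies `Φ` by monotonicity.
    minimalSize-exists : (Φ : Pred (Pred A 0ℓ) 0ℓ) → Monotone Φ → Φ U → ∃ (IsMinimalSize Φ)
    minimalSize-exists {A} Φ mono ΦU = ∣ S ∣ , (T ∘ S , ΦS , ∣∣-hasSize S) ,
      λ F μ ΦF size → ∣F∣↣ F μ size ↣-∘ least (⟨ F ⟩ , mono ⟨⟩⁺ ΦF)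
      where
      smallest = minimal-cardinal {∃[ S ] Φ (T ∘ S)} ((λ _ → true) , mono (λ _ → tt) ΦU)
        (∣_∣ ∘ proj₁)
      S     = proj₁ (proj₁ smallest)
      ΦS    = proj₂ (proj₁ smallest)
      least = proj₂ smallest

      ∣F∣↣ : (F : Pred A 0ℓ) (μ : Set) → HasSize F μ → ∣ ⟨ F ⟩ ∣ ↣ μ
      ∣F∣↣ F μ (e , ran) = mk↣ {to = λ (a , t) → proj₁ (Equivalence.to (ran a) (⟨⟩⁻ t))}
        λ {(a , t)} {(b , u)} eq → ∣∣-≡ ⟨ F ⟩
          (trans (sym (proj₂ (Equivalence.to (ran a) (⟨⟩⁻ t))))
          (trans (cong (Injection.to e) eq) (proj₂ (Equivalence.to (ran b) (⟨⟩⁻ u)))))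

    -- `image r F` injects into `κ`; `leastΨ`, obtained by carrying families back along `s`, gives
    -- the other injection, and Cantor-Schröder-Bernstein makes `κ` its size.
    minimalSizes-agree :
      (Φ : Pred (Pred A 0ℓ) 0ℓ) (Ψ : Pred (Pred B 0ℓ) 0ℓ) → Monotone Φ → Φ U →
      (r : A → B) → (∀ F → Φ F → Ψ (image r F)) →
      (s : B → A) → (∀ G → Ψ G → Φ (image s G)) →
      IsMinimalSize Φ ≡ᶜ IsMinimalSize Ψ
    minimalSizes-agree {B = B} Φ Ψ mono ΦU r Φ⇒Ψ s Ψ⇒Φ
      with κ , minΦ@((F , ΦF , size) , least) ← minimalSize-exists Φ mono ΦU =
      κ , minΦ ,
      ( image r F , Φ⇒Ψ F ΦF
      , HasSize-↣↣ (⟨⟩-hasSize (image r F))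
          (leastΨ (image r F) _ (Φ⇒Ψ F ΦF) (⟨⟩-hasSize (image r F))) (∣image∣↣ r size)) ,
      leastΨ
      where
      leastΨ : ∀ G μ → Ψ G → HasSize G μ → κ ↣ μ
      leastΨ G μ ΨG size =
        ∣image∣↣ s size ↣-∘ least (image s G) _ (Ψ⇒Φ G ΨG) (⟨⟩-hasSize (image s G))

-- Domination

eventually : {Q : Pred ℕ 0ℓ} → ∃[ N ] (∀ n → N ≤ n → Q n) → AllButFinitelyMany Q
eventually (N , q) = upTo N , λ n n∉ → q n (≮⇒≥ (n∉ ∘ ∈-upTo⁺))

eventually⁻ : {Q : Pred ℕ 0ℓ} → AllButFinitelyMany Q → ∃[ N ] (∀ n → N ≤ n → Q n)
eventually⁻ (xs , q) = 1+ (max 0 xs) , λ n N≤n → q n λ n∈ →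
  <⇒≱ N≤n (All.lookup (xs≤max 0 xs) n∈)

≤⇒≤* : ∀ {x y} → (∀ n → x n ≤ y n) → x ≤* y
≤⇒≤* x≤y = eventually (0 , λ n _ → x≤y n)

≤*-trans : ∀ {x y z} → x ≤* y → y ≤* z → x ≤* z
≤*-trans x≤y y≤z with N , p ← eventually⁻ x≤y | M , q ← eventually⁻ y≤z =
  eventually (N ⊔ M , λ n le →
    ≤-trans (p n (≤-trans (m≤m⊔n N M) le)) (q n (≤-trans (m≤n⊔m N M) le)))

1+x≰*x : ∀ x → ¬ (1+_ ∘ x ≤* x)
1+x≰*x x le with N , p ← eventually⁻ le = 1+n≰n (p N ≤-refl)

positive : ω^ω → ω^ω∖𝟘
positive g = (λ n → g n ⊔ 1) , λ g∈𝟘 → let N , z = eventually⁻ g∈𝟘 in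
  <⇒≢ (m≤n⊔m (g N) 1) (sym (z N ≤-refl))

-- Increasing majorants and their iterates

majorant : ω^ω → ω^ω
majorant f zero    = 1+ (f zero)
majorant f (1+ n) = 1+ (majorant f n ⊔ f (1+ n))

f≤majorant : ∀ f n → f n ≤ majorant f n
f≤majorant f zero    = n≤1+n _
f≤majorant f (1+ n) = m≤n⇒m≤1+n (m≤n⊔m _ _)

majorant-increasing : ∀ f {m n} → m < n → majorant f m < majorant f n
majorant-increasing f {m} {1+ n} (s≤s m≤n) with m≤n⇒m<n∨m≡n m≤n
... | inj₁ m<n  = <-≤-trans (majorant-increasing f m<n) (m≤n⇒m≤1+n (m≤m⊔n _ _))
... | inj₂ refl = s≤s (m≤m⊔n _ _)

majorant-mono : ∀ f {m n} → m ≤ n → majorant f m ≤ majorant f n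
majorant-mono f m≤n with m≤n⇒m<n∨m≡n m≤n
... | inj₁ m<n  = <⇒≤ (majorant-increasing f m<n)
... | inj₂ refl = ≤-refl

n<majorant : ∀ f n → n < majorant f n
n<majorant f zero    = s≤s z≤n
n<majorant f (1+ n) = ≤-<-trans (n<majorant f n) (s≤s (m≤m⊔n _ _))

data Iterate (f : ω^ω) : ℕ → Set where
  base : Iterate f 0
  next : ∀ {k} → Iterate f k → Iterate f (majorant f k)

-- Compare `k` with the iterate from which the later point arises. If that one came before `k`,
-- induction with the roles exchanged would put the later point at or below `k`.
iterate-gap : ∀ {f k l} → Iterate f k → Iterate f l → k < l → majorant f k ≤ l
iterate-gap {f} {k} K (next {l} L) k<l′ with <-cmp k l
... | tri< k<l _ _    = ≤-trans (iterate-gap K L k<l) (<⇒≤ (n<majorant f l))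
... | tri≈ _ refl _   = ≤-refl
... | tri> _ _ l<k    = contradiction (iterate-gap L K l<k) (<⇒≱ k<l′)

iterate-around : ∀ f n → ∃[ k ] Iterate f k × k ≤ n × n < majorant f k
iterate-around f zero = 0 , base , z≤n , s≤s z≤n
iterate-around f (1+ n) with k , K , k≤n , n<k′ ← iterate-around f n
  with m≤n⇒m<n∨m≡n n<k′
... | inj₁ 1+n<k′ = k , K , m≤n⇒m≤1+n k≤n , 1+n<k′
... | inj₂ 1+n≡k′ = majorant f k , next K , ≤-reflexive (sym 1+n≡k′) ,
  subst (_< majorant f (majorant f k)) (sym 1+n≡k′) (n<majorant f _)

-- From comparability to domination

module Comparability (em : ExcludedMiddle 0ℓ) where
  open Classical em

  -- The majorant is applied twice so that the value at `n` dominates `f` on the whole interval up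
  -- to the next iterate.
  sparse : ω^ω → ω^ω
  sparse f n with em {Iterate f n}
  ... | yes _ = majorant f (majorant f n)
  ... | no  _ = 0

  sparse-on : ∀ {f n} → Iterate f n → sparse f n ≡ majorant f (majorant f n)
  sparse-on {f} {n} K with em {Iterate f n}
  ... | yes _ = refl
  ... | no ¬K = contradiction K ¬K

  sparse-support : ∀ {f n} → 0 < sparse f n → Iterate f n
  sparse-support {f} {n} pos with em {Iterate f n}
  ... | yes K = K

  sparse∉𝟘 : ∀ f → sparse f ∉ 𝟘
  sparse∉𝟘 f s∈𝟘 with N , z ← eventually⁻ s∈𝟘 with k , K , _ , N<k′ ← iterate-around f N =
    m<n⇒n≢0 (n<majorant f _) (trans (sym (sparse-on (next K))) (z (majorant f k) (<⇒≤ N<k′)))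

  sparseₚ : ω^ω → ω^ω∖𝟘
  sparseₚ f = sparse f , sparse∉𝟘 f

  support-unbounded : (p : ω^ω∖𝟘) → ∀ n → ∃[ m ] n < m × 0 < proj₁ p m
  support-unbounded (p , p∉𝟘) n = ¬¬-elim λ none → p∉𝟘 (eventually (1+ n , λ m n<m →
    n≤0⇒n≡0 (≮⇒≥ λ 0<pm → none (m , n<m , 0<pm))))

  nextₛ : ω^ω∖𝟘 → ω^ω
  nextₛ p n = proj₁ (support-unbounded p n)

  -- One term for each way of being comparable. `nextₛ` occurs twice because the gap estimate needs
  -- two support points beyond `n`.
  bound : ω^ω∖𝟘 → ω^ω
  bound p n = nextₛ p (nextₛ p n) ⊔ majorant (proj₁ p) n

  -- Beyond the threshold the support of `p` consists of iterates, so two of its points `a < b`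
  -- satisfy `majorant f a ≤ b`.
  ≤*sparse⇒≤*bound : ∀ p f → p ≤*ₚ sparseₚ f → f ≤* bound p
  ≤*sparse⇒≤*bound p f le with N , p≤ ← eventually⁻ le = eventually (N , λ n N≤n →
    let a , n<a , pa = support-unbounded p n
        b , a<b , pb = support-unbounded p a
        N≤a = ≤-trans N≤n (<⇒≤ n<a)
        N≤b = ≤-trans N≤a (<⇒≤ a<b)
        A∈ = sparse-support (<-≤-trans pa (p≤ a N≤a))
        B∈ = sparse-support (<-≤-trans pb (p≤ b N≤b))
    in begin
      f n          ≤⟨ f≤majorant f n ⟩
      majorant f n ≤⟨ majorant-mono f (<⇒≤ n<a) ⟩
      majorant f a ≤⟨ iterate-gap A∈ B∈ a<b ⟩
      b            ≤⟨ m≤m⊔n b _ ⟩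
      bound p n    ∎)
    where open ≤-Reasoning

  sparse≤*⇒≤*bound : ∀ p f → sparseₚ f ≤*ₚ p → f ≤* bound p
  sparse≤*⇒≤*bound p f le with N , ≤p ← eventually⁻ le = eventually (majorant f N , λ n N′≤n →
    let k , K , k≤n , n<k′ = iterate-around f n
        -- The threshold `majorant f N` forces the interval around `n` to start at or after `N`,
        -- where `≤p` applies.
        N≤k = ≮⇒≥ λ k<N → <⇒≱ (<-≤-trans n<k′ (majorant-mono f (<⇒≤ k<N))) N′≤n
    in begin
      f n                       ≤⟨ f≤majorant f n ⟩
      majorant f n              ≤⟨ majorant-mono f (<⇒≤ n<k′) ⟩
      majorant f (majorant f k) ≡⟨ sparse-on K ⟨
      sparse f k                ≤⟨ ≤p k N≤k ⟩
      proj₁ p k                 ≤⟨ f≤majorant (proj₁ p) k ⟩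
      majorant (proj₁ p) k      ≤⟨ majorant-mono (proj₁ p) k≤n ⟩
      majorant (proj₁ p) n      ≤⟨ m≤n⊔m _ _ ⟩
      bound p n                 ∎)
    where open ≤-Reasoning

  -- If every `sparseₚ f` were comparable with `p`, then `bound p` would bound `F`.
  unbounded⇒incomparable : ∀ F → IsUnboundedFamily F →
                           IsIncomparableFamily _≤*ₚ_ (image sparseₚ F)
  unbounded⇒incomparable F unb p = ¬¬-elim λ none → unb (bound p , λ f f∈F → ¬¬-elim λ f≰ →
    none (sparseₚ f , (f , f∈F , refl) , f≰ ∘ ≤*sparse⇒≤*bound p f , f≰ ∘ sparse≤*⇒≤*bound p f))

  comparable⇒dominating : ∀ F → IsComparableFamily _≤*ₚ_ F → IsDominatingFamily (image bound F)
  comparable⇒dominating F comp f with comp (sparseₚ f)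
  ... | p , p∈F , inj₁ f≤p = bound p , (p , p∈F , refl) , sparse≤*⇒≤*bound p f f≤p
  ... | p , p∈F , inj₂ p≤f = bound p , (p , p∈F , refl) , ≤*sparse⇒≤*bound p f p≤f

-- From domination to comparability

≤*positive : ∀ p g → proj₁ p ≤* g → p ≤*ₚ positive g
≤*positive p g p≤g = ≤*-trans p≤g (≤⇒≤* λ n → m≤m⊔n (g n) 1)

-- If `g` were a bound, all of `F` would lie below `positive g`.
incomparable⇒unbounded : ∀ F → IsIncomparableFamily _≤*ₚ_ F → IsUnboundedFamily (image proj₁ F)
incomparable⇒unbounded F inc (g , F≤g) with p , p∈F , _ , p≰ ← inc (positive g) =
  p≰ (≤*positive p g (F≤g (proj₁ p) (p , p∈F , refl)))

dominating⇒comparable : ∀ F → IsDominatingFamily F → IsComparableFamily _≤*ₚ_ (image positive F)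
dominating⇒comparable F dom p with g , g∈F , p≤g ← dom (proj₁ p) =
  positive g , (g , g∈F , refl) , inj₁ (≤*positive p g p≤g)

≡ᶜ-sym : ∀ {Φ Ψ : Set → Set₁} → Φ ≡ᶜ Ψ → Ψ ≡ᶜ Φ
≡ᶜ-sym (κ , φ , ψ) = κ , ψ , φ

mainTheorem1 : ExcludedMiddle (suc 0ℓ) → Extensionality 0ℓ 0ℓ →
    (Is-𝔦𝔠𝔭 _≤*ₚ_ ≡ᶜ Is-𝔟) × (Is-𝔠𝔭 _≤*ₚ_ ≡ᶜ Is-𝔡)
mainTheorem1 em₁ ext =
  -- The minimum is found for unbounded families, since the whole space is visibly one: no `g`
  -- bounds its own successor.
  ≡ᶜ-sym (minimalSizes-agree IsUnboundedFamily (IsIncomparableFamily _≤*ₚ_)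
    (λ F⊆G unb (g , G≤g) → unb (g , λ f f∈F → G≤g f (F⊆G f∈F)))
    (λ (g , U≤g) → 1+x≰*x g (U≤g (1+_ ∘ g) tt))
    sparseₚ unbounded⇒incomparable proj₁ incomparable⇒unbounded) ,
  ≡ᶜ-sym (minimalSizes-agree IsDominatingFamily (IsComparableFamily _≤*ₚ_)
    (λ F⊆G dom f → let g , g∈F , f≤g = dom f in g , F⊆G g∈F , f≤g)
    (λ f → f , tt , ≤⇒≤* λ _ → ≤-refl)
    positive dominating⇒comparable bound comparable⇒dominating)
  where
  em : ExcludedMiddle 0ℓ
  em {P} = map′ lower lift (em₁ {Lift (suc 0ℓ) P})

  open Classical em
  open Choice ext
  open Comparability em
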